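{- Let $D$ be a digraph without useless arcs and let $k\geq 1$ be an integer. If $\ell(D)\geq 3k$, then $\ell_s(D)\geq k$, i.e. $D$ has an out-branching with at least $k$ leaves.
   Context: An out-tree of a digraph $D$ is a subgraph of $D$ that is a tree (ignoring arc directions) in which exactly one vertex, the root, has in-degree $0$ and every other vertex has in-degree $1$. An out-branching is a spanning out-tree. A leaf is a vertex of out-degree $0$ in the out-tree. $\ell(D)$ and $\ell_s(D)$ denote the maximum number of leaves over all out-trees and over all out-branchings of $D$, respectively. An arc of $D$ is useless if no out-branching of $D$ contains it. -}

module Defs where

open import Data.Bool using (Bool; T)
open import Data.Nat using (ℕ; _≤_; _≟_)
open import Data.Fin using (Fin)
open import Data.Fin.Subset using (Subset; _∈_; _∩_; ∣_∣; Nonempty)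
open import Data.Vec using (tabulate)
open import Data.List using (_∷_; []; _∷ʳ_)
open import Data.List.Relation.Unary.Linked using (Linked)
open import Data.List.Relation.Unary.Unique.Propositional using (Unique)
open import Data.Product using (_×_; ∃-syntax)
open import Relation.Nullary using (¬_; does)
open import Relation.Binary using (Rel; Asymmetric)
open import Relation.Binary.Construct.Closure.Symmetric using (SymClosure)
open import Relation.Binary.Construct.Closure.Equivalence using (EqClosure)
open import Relation.Binary.PropositionalEquality using (_≡_; _≢_)
open import Level using (0ℓ)

-- Finite digraphs on the vertex set Fin n, without parallel arcs.  Antiparallel
-- arcs are allowed; so are loops, but a loop lies in no out-branching.
record Digraph (n : ℕ) : Set where
  field
    arc : Fin n → Fin n → Bool

  Arc : Rel (Fin n) 0ℓ
  Arc u v = T (arc u v)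

record Subgraph {n : ℕ} (D : Digraph n) : Set where
  field
    verts : Subset n
    graph : Digraph n

  open Digraph graph public

  field
    arc⊆ : ∀ {u v} → Arc u v → Digraph.Arc D u v
    tail∈ : ∀ {u v} → Arc u v → u ∈ verts
    head∈ : ∀ {u v} → Arc u v → v ∈ verts

  outdeg indeg : Fin n → ℕ
  outdeg u = ∣ tabulate (λ v → arc u v) ∣
  indeg  v = ∣ tabulate (λ u → arc u v) ∣

  #leaves : ℕ
  #leaves = ∣ verts ∩ tabulate (λ v → does (outdeg v ≟ 0)) ∣

module _ {n : ℕ} {D : Digraph n} where

  -- The underlying undirected multigraph is a tree: a loop is a cycle of
  -- length 1 and a pair of antiparallel arcs a cycle of length 2, and both are
  -- excluded by asymmetry of Arc.
  record IsTree (H : Subgraph D) : Set where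
    open Subgraph H
    field
      nonempty      : Nonempty verts
      connected     : ∀ {u v} → u ∈ verts → v ∈ verts → EqClosure Arc u v
      noShortCycle  : Asymmetric Arc
      noLongerCycle : ∀ x y z zs → let c = x ∷ y ∷ z ∷ zs in
                      Unique c → ¬ Linked (SymClosure Arc) (c ∷ʳ x)

  record IsOutTree (H : Subgraph D) : Set where
    open Subgraph H
    field
      isTree     : IsTree H
      root       : Fin n
      root∈      : root ∈ verts
      root-indeg : indeg root ≡ 0
      indeg≡1    : ∀ {v} → v ∈ verts → v ≢ root → indeg v ≡ 1

  record IsOutBranching (H : Subgraph D) : Set where
    open Subgraph H
    field
      isOutTree : IsOutTree H
      spanning  : ∀ v → v ∈ verts

module _ {n : ℕ} (D : Digraph n) where

  UselessArc : Rel (Fin n) 0ℓ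
  UselessArc u v = Digraph.Arc D u v ×
    ¬ (∃[ B ] IsOutBranching {D = D} B × Subgraph.Arc B u v)

  NoUselessArcs : Set
  NoUselessArcs = ∀ u v → ¬ UselessArc u v

  IsMaxLeaves : (Subgraph D → Set) → ℕ → Set
  IsMaxLeaves P m =
    (∃[ H ] P H × Subgraph.#leaves H ≡ m) ×
    (∀ H → P H → Subgraph.#leaves H ≤ m)

-- "ℓ(D) = m" and "ℓₛ(D) = m".  These are relations because the maximum need
-- not exist: a digraph may have no out-branching (or no vertex at all).
ℓ[_]≡_ ℓₛ[_]≡_ : ∀ {n} → Digraph n → ℕ → Set
ℓ[ D ]≡ m  = IsMaxLeaves D IsOutTree m
ℓₛ[ D ]≡ m = IsMaxLeaves D IsOutBranching m

{-# OPTIONS --safe #-}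

-- Let T be an out-tree with root q and at least 3k leaves, and r the root of an
-- out-branching.  If Y is a set of vertices each reachable from r by a walk whose
-- earlier vertices avoid Y, then growing a tree first inside the complement of Y
-- and then arbitrarily yields an out-branching with at least |Y| leaves, so such a
-- Y of size k is wanted.  If q reaches r, start from q and take the leaves of T.
-- Otherwise every arc uv of T is useful from r: some walk from r reaches u and
-- avoids v.  Let X be the set of leaves of T that dominate q, that is, lie on
-- every walk from r to q.
--
-- If |X| < k, at least 2k leaves do not dominate q, and some walk from r to q
-- avoids half of them; continue it inside T to get Y.
--
-- If |X| ≥ k, let y(d), for d in X, be the first vertex on the path of T from q to
-- d that d does not dominate.  It does not dominate d, and all other dominators
-- of d among the leaves dominate it.  As the vertices of X are linearly ordered by
-- dominance, d ↦ y(d) is injective and Y can be taken to be its image.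
module Submission where

open import Defs
open import Data.Bool using (Bool; T)
open import Data.Bool.Properties using (T-≡; T?)
open import Data.Empty using (⊥-elim)
open import Data.Fin using (Fin; zero; suc)
open import Data.Fin.Properties using (any?; all?; _≟_; suc-injective)
open import Data.Fin.Subset as Subset
  using (Subset; inside; outside; _∈_; _∉_; _⊆_; _∩_; _∪_; _-_; ∁; ⁅_⁆; ∣_∣)
open import Data.Fin.Subset.Properties
open import Data.Fin.Subset.Induction using (⊂-wellFounded; ⊃-wellFounded; Acc; acc)
open import Data.List using (_∷_; []; _∷ʳ_)
open import Data.List.Membership.Propositional using () renaming (_∈_ to _∈ˡ_)
open import Data.List.Relation.Unary.All as All using ([]; _∷_)
open import Data.List.Relation.Unary.AllPairs as AllPairs using ([]; _∷_)
import Data.List.Relation.Unary.AllPairs.Properties as AllPairs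
open import Data.List.Relation.Unary.Any using (here; there)
open import Data.List.Relation.Unary.Linked using (Linked; _∷_)
open import Data.List.Relation.Unary.Unique.Propositional using (Unique)
open import Data.Nat using (ℕ; zero; suc; _+_; _*_; _≤_; _<_; _≥_; z≤n; s≤s; s≤s⁻¹)
import Data.Nat as ℕ
open import Data.Nat.Properties hiding (_≟_; suc-injective)
open import Data.Product using (_×_; ∃-syntax; _,_; proj₁; proj₂)
open import Data.Sum using (_⊎_; inj₁; inj₂)
open import Data.Vec using ([]; _∷_; tabulate; here; there)
open import Data.Vec.Properties using ([]=⇒lookup; lookup⇒[]=; lookup∘tabulate)
open import Data.Vec.Functional using (updateAt)
open import Data.Vec.Functional.Properties using (updateAt-updates; updateAt-minimal)
open import Function using (_∘_; const; case_of_; Equivalence)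
open import Level using (0ℓ)
open import Relation.Binary using (Rel)
open import Relation.Binary.Construct.Closure.Equivalence as EqClosure using (EqClosure)
open import Relation.Binary.Construct.Closure.Symmetric using (SymClosure; fwd; bwd)
open import Relation.Binary.Construct.Closure.ReflexiveTransitive
  using (Star; ε; _◅_; _◅◅_)
import Relation.Binary.Construct.Closure.ReflexiveTransitive as Star
open import Relation.Binary.PropositionalEquality
open import Relation.Nullary
open import Relation.Nullary.Decidable using (_×-dec_; ¬?; map′; decidable-stable; dec-true)
open import Relation.Unary using (Pred; Decidable; U)
open import Relation.Unary.Properties using (U?)

-- Cardinalities of finite subsets

private variable
  n n′ : ℕ
  p : Subset n
  x y : Fin n

∣p∣≡∣p∩q∣+∣p∩∁q∣ : ∀ (p q : Subset n) → ∣ p ∣ ≡ ∣ p ∩ q ∣ + ∣ p ∩ ∁ q ∣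
∣p∣≡∣p∩q∣+∣p∩∁q∣ []            []            = refl
∣p∣≡∣p∩q∣+∣p∩∁q∣ (outside ∷ p) (_ ∷ q)       = ∣p∣≡∣p∩q∣+∣p∩∁q∣ p q
∣p∣≡∣p∩q∣+∣p∩∁q∣ (inside ∷ p)  (inside ∷ q)  = cong suc (∣p∣≡∣p∩q∣+∣p∩∁q∣ p q)
∣p∣≡∣p∩q∣+∣p∩∁q∣ (inside ∷ p)  (outside ∷ q) =
  trans (cong suc (∣p∣≡∣p∩q∣+∣p∩∁q∣ p q)) (sym (+-suc _ _))

∣∣-cover : ∀ (s p q : Subset n) → (∀ {x} → x ∈ s → x ∉ p → x ∈ q) → ∣ s ∣ ≤ ∣ p ∣ + ∣ q ∣
∣∣-cover s p q covered =
  subst (_≤ ∣ p ∣ + ∣ q ∣) (sym (∣p∣≡∣p∩q∣+∣p∩∁q∣ s p))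
    (+-mono-≤ (∣p∩q∣≤∣q∣ s p)
      (p⊆q⇒∣p∣≤∣q∣ λ x∈ → let x∈s , x∈∁p = x∈p∩q⁻ s (∁ p) x∈
                           in covered x∈s (x∈∁p⇒x∉p x∈∁p)))

∣∣-pack : ∀ (s p q : Subset n) → p ⊆ s → q ⊆ s → (∀ {x} → x ∈ p → x ∉ q) → ∣ p ∣ + ∣ q ∣ ≤ ∣ s ∣
∣∣-pack s p q p⊆s q⊆s disjoint =
  subst (∣ p ∣ + ∣ q ∣ ≤_) (sym (∣p∣≡∣p∩q∣+∣p∩∁q∣ s p))
    (+-mono-≤ (p⊆q⇒∣p∣≤∣q∣ λ x∈p → x∈p∩q⁺ (p⊆s x∈p , x∈p))
      (p⊆q⇒∣p∣≤∣q∣ λ x∈q → x∈p∩q⁺ (q⊆s x∈q , x∉p⇒x∈∁p λ x∈p → disjoint x∈p x∈q)))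

∣p∪⁅x⁆∣≤1+∣p∣ : ∀ (p : Subset n) x → ∣ p ∪ ⁅ x ⁆ ∣ ≤ suc ∣ p ∣
∣p∪⁅x⁆∣≤1+∣p∣ p x = begin
  ∣ p ∪ ⁅ x ⁆ ∣      ≤⟨ ∣∣-cover (p ∪ ⁅ x ⁆) ⁅ x ⁆ p (λ y∈ y∉ → split y∈ y∉) ⟩
  ∣ ⁅ x ⁆ ∣ + ∣ p ∣  ≡⟨ cong (_+ ∣ p ∣) (∣⁅x⁆∣≡1 x) ⟩
  suc ∣ p ∣          ∎
  where
  open ≤-Reasoning
  split : ∀ {y} → y ∈ p ∪ ⁅ x ⁆ → y ∉ ⁅ x ⁆ → y ∈ p
  split y∈ y∉ with x∈p∪q⁻ p ⁅ x ⁆ y∈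
  ... | inj₁ y∈p = y∈p
  ... | inj₂ y∈x = contradiction y∈x y∉

∣p∣≤1+∣p-x∣ : ∀ (p : Subset n) x → ∣ p ∣ ≤ suc ∣ p - x ∣
∣p∣≤1+∣p-x∣ p x = subst (λ c → ∣ p ∣ ≤ c + ∣ p - x ∣) (∣⁅x⁆∣≡1 x)
  (∣∣-cover p ⁅ x ⁆ (p - x) λ y∈p y∉x → x∈p∧x≢y⇒x∈p-y y∈p (x∉⁅y⁆⇒x≢y y∉x))

1+∣p∣≤∣p∪⁅x⁆∣ : x ∉ p → suc ∣ p ∣ ≤ ∣ p ∪ ⁅ x ⁆ ∣
1+∣p∣≤∣p∪⁅x⁆∣ {x = x} {p = p} x∉p =
  p⊂q⇒∣p∣<∣q∣ (p⊆p∪q ⁅ x ⁆ , x , q⊆p∪q p ⁅ x ⁆ (x∈⁅x⁆ x) , x∉p)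

∈-∪⁅⁆⁻ : ∀ (p : Subset n) → y ∈ p ∪ ⁅ x ⁆ → y ≢ x → y ∈ p
∈-∪⁅⁆⁻ {x = x} p y∈ y≢x with x∈p∪q⁻ p ⁅ x ⁆ y∈
... | inj₁ y∈p = y∈p
... | inj₂ y∈x = contradiction (x∈⁅y⁆⇒x≡y x y∈x) y≢x

x∈p∪⁅x⁆ : ∀ (p : Subset n) → x ∈ p ∪ ⁅ x ⁆
x∈p∪⁅x⁆ {x = x} p = q⊆p∪q p ⁅ x ⁆ (x∈⁅x⁆ x)

x∈p-y⇒x≢y : ∀ (p : Subset n) → x ∈ p - y → x ≢ y
x∈p-y⇒x≢y {x = zero}  {y = zero}  (inside ∷ p)  ()
x∈p-y⇒x≢y {x = zero}  {y = zero}  (outside ∷ p) ()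
x∈p-y⇒x≢y {x = suc _} {y = suc _} (_ ∷ p) (there x∈) refl = x∈p-y⇒x≢y p x∈ refl

∈-tabulate⁺ : ∀ {f : Fin n → Bool} → T (f x) → x ∈ tabulate f
∈-tabulate⁺ {x = x} {f = f} Tfx =
  lookup⇒[]= x (tabulate f) (trans (lookup∘tabulate f x) (Equivalence.to T-≡ Tfx))

∈-tabulate⁻ : ∀ {f : Fin n → Bool} → x ∈ tabulate f → T (f x)
∈-tabulate⁻ {x = x} {f = f} x∈ =
  Equivalence.from T-≡ (trans (sym (lookup∘tabulate f x)) ([]=⇒lookup x∈))

T-does⁺ : ∀ {A : Set} (a? : Dec A) → A → T (does a?)
T-does⁺ a? a = Equivalence.from T-≡ (dec-true a? a)

T-does⁻ : ∀ {A : Set} (a? : Dec A) → T (does a?) → A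
T-does⁻ (yes a) _ = a

module _ {P : Pred (Fin n) 0ℓ} (P? : Decidable P) where

  ⟦_⟧ : Subset n
  ⟦_⟧ = tabulate (does ∘ P?)

  ∈-⟦⟧⁺ : P x → x ∈ ⟦_⟧
  ∈-⟦⟧⁺ {x = x} Px = ∈-tabulate⁺ (T-does⁺ (P? x) Px)

  ∈-⟦⟧⁻ : x ∈ ⟦_⟧ → P x
  ∈-⟦⟧⁻ {x = x} x∈ = T-does⁻ (P? x) (∈-tabulate⁻ x∈)

∣p∣≡0⇒x∉p : ∀ (p : Subset n) → ∣ p ∣ ≡ 0 → x ∉ p
∣p∣≡0⇒x∉p {x = x} p ∣p∣≡0 x∈p = n≮0 (subst (∣ p - x ∣ <_) ∣p∣≡0 (x∈p⇒∣p-x∣<∣p∣ x∈p))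

∣p∣≡1⇒x≡y : ∀ (p : Subset n) → ∣ p ∣ ≡ 1 → x ∈ p → y ∈ p → x ≡ y
∣p∣≡1⇒x≡y {x = x} {y = y} p ∣p∣≡1 x∈p y∈p with x ≟ y
... | yes x≡y = x≡y
... | no  x≢y = ⊥-elim (∣p∣≡0⇒x∉p (p - y)
  (n<1⇒n≡0 (subst (∣ p - y ∣ <_) ∣p∣≡1 (x∈p⇒∣p-x∣<∣p∣ y∈p)))
  (x∈p∧x≢y⇒x∈p-y x∈p x≢y))

∣p∣≡1 : x ∈ p → (∀ {y} → y ∈ p → y ≡ x) → ∣ p ∣ ≡ 1
∣p∣≡1 {x = x} {p = p} x∈p unique = trans (cong ∣_∣ (⊆-antisym {i = p} {j = ⁅ x ⁆}
   (λ y∈p → subst (_∈ ⁅ x ⁆) (sym (unique y∈p)) (x∈⁅x⁆ x))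
   (λ y∈x → subst (_∈ p) (sym (x∈⁅y⁆⇒x≡y x y∈x)) x∈p)))
   (∣⁅x⁆∣≡1 x)

∣p∣≡0 : (∀ {y} → y ∉ p) → ∣ p ∣ ≡ 0
∣p∣≡0 {n} {p = p} empty = trans (cong ∣_∣ (Empty-unique (λ (_ , y∈p) → empty y∈p))) (∣⊥∣≡0 n)

-- Induction on `p`: the image of its first element is deleted from `q`, and injectivity keeps the
-- other images in what remains.
injection⇒∣p∣≤∣q∣ : ∀ {p : Subset n} {q : Subset n′} (f : Fin n → Fin n′) →
  (∀ {x} → x ∈ p → f x ∈ q) →
  (∀ {x y} → x ∈ p → y ∈ p → f x ≡ f y → x ≡ y) →
  ∣ p ∣ ≤ ∣ q ∣
injection⇒∣p∣≤∣q∣ {p = []} f into inj = z≤n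
injection⇒∣p∣≤∣q∣ {p = outside ∷ p} f into inj =
  injection⇒∣p∣≤∣q∣ {p = p} (f ∘ suc) (into ∘ there)
    λ x∈ y∈ eq → suc-injective (inj (there x∈) (there y∈) eq)
injection⇒∣p∣≤∣q∣ {p = inside ∷ p} f into inj =
  ≤-trans
    (s≤s (injection⇒∣p∣≤∣q∣ {p = p} (f ∘ suc)
      (λ x∈ → x∈p∧x≢y⇒x∈p-y (into (there x∈))
        λ eq → case inj (there x∈) here eq of λ ())
      λ x∈ y∈ eq → suc-injective (inj (there x∈) (there y∈) eq)))
    (x∈p⇒∣p-x∣<∣p∣ (into here))

-- Walks and avoidance

module _ {n : ℕ} {E : Rel (Fin n) 0ℓ} where

  invariant : ∀ (P : Pred (Fin n) 0ℓ) → (∀ {u v} → E u v → P u → P v) →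
    ∀ {a v} → Star E a v → P a → P v
  invariant P step ε       Pa = Pa
  invariant P step (e ◅ w) Pa = invariant P step w (step e Pa)

  _◅ʳ_ : ∀ {a u v} → Star E a u → E u v → Star E a v
  w ◅ʳ e = w ◅◅ e ◅ ε

  unsnoc : ∀ {a v} → Star E a v → v ≡ a ⊎ ∃[ u ] Star E a u × E u v
  unsnoc {a} w = invariant (λ v → v ≡ a ⊎ ∃[ u ] Star E a u × E u v) extend w (inj₁ refl)
    where
    extend : ∀ {u v} → E u v → u ≡ a ⊎ ∃[ t ] Star E a t × E t u →
      v ≡ a ⊎ ∃[ t ] Star E a t × E t v
    extend e (inj₁ refl)         = inj₂ (_ , ε , e)
    extend e (inj₂ (_ , w , e′)) = inj₂ (_ , w ◅ʳ e′ , e)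

-- `P` is required of tails only, hence of every vertex but the last: a walk may end in the set that
-- it avoids.
Walk : ∀ {n} → Rel (Fin n) 0ℓ → Pred (Fin n) 0ℓ → Rel (Fin n) 0ℓ
Walk E P = Star (λ u v → P u × E u v)

-- The walk is followed until it is about to leave `d`; in that case the part up to `d` is kept.
firstVisit : ∀ {n} {E : Rel (Fin n) 0ℓ} d {a v} → Star E a v →
  Walk E (_≢ d) a d ⊎ Walk E (_≢ d) a v
firstVisit {E = E} d {a} w =
  invariant (λ v → Walk E (_≢ d) a d ⊎ Walk E (_≢ d) a v) extend w (inj₂ ε)
  where
  extend : ∀ {u v} → E u v → Walk E (_≢ d) a d ⊎ Walk E (_≢ d) a u →
    Walk E (_≢ d) a d ⊎ Walk E (_≢ d) a v
  extend e (inj₁ w) = inj₁ w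
  extend {u} e (inj₂ w) with u ≟ d
  ... | yes refl = inj₁ w
  ... | no  u≢d  = inj₂ (w ◅ʳ (u≢d , e))

truncate : ∀ {n} {E : Rel (Fin n) 0ℓ} {a d} → Star E a d → Walk E (_≢ d) a d
truncate {d = d} w with firstVisit d w
... | inj₁ w′ = w′
... | inj₂ w′ = w′

-- Growing trees from a root

module _ {n : ℕ} (D : Digraph n) (r : Fin n) where
  open Digraph D

  -- A tree on `S` in the form of parent pointers, with `rank` excluding cycles. Every vertex with a
  -- child lies in `I`, so at least `c` vertices of `S` are leaves.
  record PartialTree (P : Pred (Fin n) 0ℓ) (c : ℕ) (S I : Subset n) : Set where
    field
      root∈S    : r ∈ S
      I⊆S       : I ⊆ S
      I⊆P       : ∀ {v} → v ∈ I → P v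
      ∣I∣+c≤∣S∣ : ∣ I ∣ + c ≤ ∣ S ∣
      parent    : Fin n → Fin n
      rank      : Fin n → ℕ
      parent∈I  : ∀ {v} → v ∈ S → v ≢ r → parent v ∈ I
      parentArc : ∀ {v} → v ∈ S → v ≢ r → Arc (parent v) v
      rank<     : ∀ {v} → v ∈ S → v ≢ r → rank (parent v) < rank v

    fromRoot : ∀ {E : Rel (Fin n) 0ℓ} → (∀ {v} → v ∈ S → v ≢ r → E (parent v) v) →
      ∀ {v} → v ∈ S → Star E r v
    fromRoot {E} e v∈S = go _ ≤-refl v∈S
      where
      go : ∀ b {v} → rank v ≤ b → v ∈ S → Star E r v
      go b {v} rank≤b v∈S with v ≟ r
      ... | yes refl = ε
      go zero    rank≤b v∈S | no v≢r = contradiction (≤-trans (rank< v∈S v≢r) rank≤b) n≮0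
      go (suc b) rank≤b v∈S | no v≢r =
        go b (s≤s⁻¹ (≤-trans (rank< v∈S v≢r) rank≤b)) (I⊆S (parent∈I v∈S v≢r)) ◅ʳ e v∈S v≢r

    walkTo : ∀ {v} → v ∈ S → Walk Arc P r v
    walkTo = fromRoot λ v∈S v≢r → I⊆P (parent∈I v∈S v≢r) , parentArc v∈S v≢r

  open PartialTree

  private variable
    P P′ : Pred (Fin n) 0ℓ
    c c′ : ℕ
    S S′ I I′ : Subset n

  reweight : (∀ {v} → v ∈ I → P′ v) → ∣ I ∣ + c′ ≤ ∣ S ∣ →
    PartialTree P c S I → PartialTree P′ c′ S I
  reweight I⊆P′ ≤S t = record
    { root∈S = root∈S t ; I⊆S = I⊆S t ; I⊆P = I⊆P′ ; ∣I∣+c≤∣S∣ = ≤S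
    ; parent = parent t ; rank = rank t
    ; parent∈I = parent∈I t ; parentArc = parentArc t ; rank< = rank< t }

  singleton : PartialTree P 0 ⁅ r ⁆ Subset.⊥
  singleton = record
    { root∈S = x∈⁅x⁆ r
    ; I⊆S = λ x∈⊥ → contradiction x∈⊥ ∉⊥
    ; I⊆P = λ x∈⊥ → contradiction x∈⊥ ∉⊥
    ; ∣I∣+c≤∣S∣ = subst (_≤ ∣ ⁅ r ⁆ ∣) (sym (trans (+-identityʳ _) (∣⊥∣≡0 n))) z≤n
    ; parent = λ v → v
    ; rank = λ _ → 0
    ; parent∈I = λ v∈ v≢r → contradiction (x∈⁅y⁆⇒x≡y r v∈) v≢r
    ; parentArc = λ v∈ v≢r → contradiction (x∈⁅y⁆⇒x≡y r v∈) v≢r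
    ; rank< = λ v∈ v≢r → contradiction (x∈⁅y⁆⇒x≡y r v∈) v≢r
    }

  -- One vertex joins `S` and at most one joins `I`, so the guaranteed number `c` of leaves
  -- survives.
  attach : ∀ {u w} → u ∈ S → P u → Arc u w → w ∉ S →
    PartialTree P c S I → PartialTree P c (S ∪ ⁅ w ⁆) (I ∪ ⁅ u ⁆)
  attach {S = S} {P = P} {c = c} {I = I} {u} {w} u∈S Pu e w∉S t = record
    { root∈S = p⊆p∪q ⁅ w ⁆ (root∈S t)
    ; I⊆S = I∪u⊆
    ; I⊆P = I∪u⊆P
    ; ∣I∣+c≤∣S∣ = ≤-trans (+-monoˡ-≤ c (∣p∪⁅x⁆∣≤1+∣p∣ I u))
                    (≤-trans (s≤s (∣I∣+c≤∣S∣ t)) (1+∣p∣≤∣p∪⁅x⁆∣ w∉S))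
    ; parent = parent′
    ; rank = rank′
    ; parent∈I = λ v∈ v≢r → proj₁ (ok v∈ v≢r)
    ; parentArc = λ v∈ v≢r → proj₁ (proj₂ (ok v∈ v≢r))
    ; rank< = λ v∈ v≢r → proj₂ (proj₂ (ok v∈ v≢r))
    }
    where
    parent′ : Fin n → Fin n
    parent′ = updateAt (parent t) w (const u)
    rank′ : Fin n → ℕ
    rank′ = updateAt (rank t) w (const (suc (rank t u)))
    I∪u⊆ : I ∪ ⁅ u ⁆ ⊆ S ∪ ⁅ w ⁆
    I∪u⊆ x∈ with x∈p∪q⁻ I ⁅ u ⁆ x∈
    ... | inj₁ x∈I = p⊆p∪q ⁅ w ⁆ (I⊆S t x∈I)
    ... | inj₂ x∈u rewrite x∈⁅y⁆⇒x≡y u x∈u = p⊆p∪q ⁅ w ⁆ u∈S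
    I∪u⊆P : ∀ {v} → v ∈ I ∪ ⁅ u ⁆ → P v
    I∪u⊆P x∈ with x∈p∪q⁻ I ⁅ u ⁆ x∈
    ... | inj₁ x∈I = I⊆P t x∈I
    ... | inj₂ x∈u rewrite x∈⁅y⁆⇒x≡y u x∈u = Pu
    rank′-old : ∀ {v} → v ∈ S → rank′ v ≡ rank t v
    rank′-old {v} v∈S = updateAt-minimal v w (rank t) λ { refl → w∉S v∈S }
    ok : ∀ {v} → v ∈ S ∪ ⁅ w ⁆ → v ≢ r →
      parent′ v ∈ I ∪ ⁅ u ⁆ × Arc (parent′ v) v × rank′ (parent′ v) < rank′ v
    ok {v} v∈ v≢r with v ≟ w
    ... | yes refl
      rewrite updateAt-updates w {const u} (parent t)
            | updateAt-updates w {const (suc (rank t u))} (rank t)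
            | rank′-old u∈S
      = x∈p∪⁅x⁆ I , e , ≤-refl
    ... | no v≢w
      rewrite updateAt-minimal v w {const u} (parent t) v≢w
            | rank′-old (∈-∪⁅⁆⁻ S v∈ v≢w)
            | rank′-old (I⊆S t (parent∈I t (∈-∪⁅⁆⁻ S v∈ v≢w) v≢r))
      = let v∈S = ∈-∪⁅⁆⁻ S v∈ v≢w
        in p⊆p∪q ⁅ u ⁆ (parent∈I t v∈S v≢r) , parentArc t v∈S v≢r , rank< t v∈S v≢r

  Closed : Pred (Fin n) 0ℓ → Subset n → Set
  Closed P S = ∀ {u v} → u ∈ S → P u → Arc u v → v ∈ S

  grow : Decidable P → Acc Subset._⊃_ S → PartialTree P c S I →
    ∃[ S′ ] ∃[ I′ ] S ⊆ S′ × PartialTree P c S′ I′ × Closed P S′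
  grow {S = S} P? (acc rec) t
    with any? (λ u → any? (λ v → u ∈? S ×-dec P? u ×-dec T? (arc u v) ×-dec ¬? (v ∈? S)))
  ... | no  ¬exit = S , _ , (λ x∈ → x∈) , t ,
    λ {u} {v} u∈S Pu e → decidable-stable (v ∈? S) λ v∉S → ¬exit (u , v , u∈S , Pu , e , v∉S)
  ... | yes (u , w , u∈S , Pu , e , w∉S) =
    let S⊆ = p⊆p∪q ⁅ w ⁆
        S′ , I′ , ⊆S′ , t′ , closed =
          grow P? (rec (S⊆ , w , x∈p∪⁅x⁆ S , w∉S)) (attach u∈S Pu e w∉S t)
    in S′ , I′ , (λ x∈ → ⊆S′ (S⊆ x∈)) , t′ , closed

  closed-reach : Closed P S → r ∈ S → ∀ {v} → Walk Arc P r v → v ∈ S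
  closed-reach {P = P} {S = S} closed r∈S w = invariant (_∈ S) (λ (Pu , e) u∈S → closed u∈S Pu e) w r∈S

  -- When growth stops, `S` is closed and hence consists of exactly the vertices that such walks
  -- reach.
  walk? : Decidable P → ∀ v → Dec (Walk Arc P r v)
  walk? P? v =
    let S , I , _ , t , closed = grow P? (⊃-wellFounded _) singleton
    in map′ (walkTo t) (closed-reach closed (root∈S t)) (v ∈? S)

  -- The second growth may expand vertices of `Y`, so these need not end as leaves; only their
  -- number is preserved.
  spanningTree : ∀ Y → (∀ v → Star Arc r v) → (∀ {y} → y ∈ Y → Walk Arc (_∉ Y) r y) →
    ∃[ I ] PartialTree U ∣ Y ∣ Subset.⊤ I
  spanningTree Y reach reachY =
    let S , I , _ , t , closed = grow (λ v → ¬? (v ∈? Y)) (⊃-wellFounded _) singleton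
        Y⊆S = λ {y} y∈Y → closed-reach {S = S} closed (root∈S t) (reachY {y} y∈Y)
        -- The first tree contains `Y` and has expanded none of it, so `I` and `Y` are disjoint
        -- parts of `S` and the count can be raised from 0 to `∣ Y ∣`.
        t₁ = reweight (λ _ → _) (∣∣-pack S I Y (I⊆S t) Y⊆S (I⊆P t)) t
        S′ , I′ , _ , t′ , closed′ = grow U? (⊃-wellFounded _) t₁
        S′≡⊤ = ⊆-antisym {i = S′} ⊆⊤ λ {v} _ →
          closed-reach closed′ (root∈S t′) (Star.map (λ e → _ , e) (reach v))
    in I′ , subst (λ s → PartialTree U _ s I′) S′≡⊤ t′

-- Acyclicity from ranks and unique in-arcs

module _ {n : ℕ} {E : Rel (Fin n) 0ℓ} (rank : Fin n → ℕ)
  (rank< : ∀ {u v} → E u v → rank u < rank v)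
  (unique : ∀ {u u′ v} → E u v → E u′ v → u ≡ u′) where

  -- A backward arc right after `e` would give `b` two distinct in-neighbours. The tail of the arc
  -- into `w` is returned so that `acyclic` can compare it with another in-neighbour of `w`.
  ascend : ∀ {a b w} zs → E a b → Linked (SymClosure E) (b ∷ zs ∷ʳ w) →
    Unique (a ∷ b ∷ zs ∷ʳ w) → rank a < rank w × ∃[ p ] p ∈ˡ (b ∷ zs) × E p w
  ascend []       e (fwd e′ ∷ _) _ = <-trans (rank< e) (rank< e′) , _ , here refl , e′
  ascend []       e (bwd e′ ∷ _) ((_ ∷ a≢w ∷ _) ∷ _) = contradiction (unique e e′) a≢w
  ascend (c ∷ zs) e (fwd e′ ∷ l) (_ ∷ uniq) =
    let lt , p , p∈ , e″ = ascend zs e′ l uniq in <-trans (rank< e) lt , p , there p∈ , e″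
  ascend (c ∷ zs) e (bwd e′ ∷ _) ((_ ∷ a≢c ∷ _) ∷ _) = contradiction (unique e e′) a≢c

  descend : ∀ {a w} zs → Linked (SymClosure E) (a ∷ zs ∷ʳ w) →
    Unique (a ∷ zs ∷ʳ w) → rank w < rank a ⊎ ∃[ p ] p ∈ˡ (a ∷ zs) × E p w
  descend []       (fwd e ∷ _) _ = inj₂ (_ , here refl , e)
  descend []       (bwd e ∷ _) _ = inj₁ (rank< e)
  descend (b ∷ zs) (fwd e ∷ l) uniq =
    let _ , p , p∈ , e′ = ascend zs e l uniq in inj₂ (p , there p∈ , e′)
  descend (b ∷ zs) (bwd e ∷ l) (_ ∷ uniq) with descend zs l uniq
  ... | inj₁ lt            = inj₁ (<-trans lt (rank< e))
  ... | inj₂ (p , p∈ , e′) = inj₂ (p , there p∈ , e′)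

  -- As each vertex has at most one in-arc, a walk without backtracking that has once
  -- followed an arc forwards never follows one backwards.
  acyclic : ∀ x y z zs → Unique (x ∷ y ∷ z ∷ zs) →
    ¬ Linked (SymClosure E) (x ∷ y ∷ z ∷ zs ∷ʳ x)
  acyclic x y z zs (x∉@(_ ∷ x≢z ∷ _) ∷ uniq@(y∉ ∷ _)) = cycle
    where
    -- The cycle is cut at `x`, which becomes the end of a walk from `y`; the arc between `x` and
    -- `y` is treated separately.
    rotated : Unique (y ∷ z ∷ zs ∷ʳ x)
    rotated = AllPairs.++⁺ uniq ([] ∷ []) (All.map (λ x≢v → (x≢v ∘ sym) ∷ []) x∉)
    y≢ : ∀ {p} → p ∈ˡ (z ∷ zs) → y ≢ p
    y≢ = All.lookup y∉
    cycle : ¬ Linked (SymClosure E) (x ∷ y ∷ z ∷ zs ∷ʳ x)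
    cycle (fwd e ∷ bwd e′ ∷ _) = x≢z (unique e e′)
    cycle (fwd e ∷ fwd e′ ∷ l) = <-asym (rank< e) (proj₁ (ascend zs e′ l rotated))
    cycle (bwd e ∷ fwd e′ ∷ l) =
      let _ , p , p∈ , e″ = ascend zs e′ l rotated in y≢ p∈ (unique e e″)
    cycle (bwd e ∷ bwd e′ ∷ l) with descend zs l (AllPairs.tail rotated)
    ... | inj₁ lt            = <-asym (rank< e) (<-trans lt (rank< e′))
    ... | inj₂ (p , p∈ , e″) = y≢ p∈ (unique e e″)

-- The out-branching given by a spanning partial tree

module _ {n : ℕ} {D : Digraph n} {r : Fin n} {P : Pred (Fin n) 0ℓ} {c : ℕ} {I : Subset n}
  (t : PartialTree D r P c Subset.⊤ I) where
  open PartialTree t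

  private
    -- The value `parent r` is arbitrary, so arcs into `r` are excluded explicitly.
    edge? : ∀ u v → Dec (v ≢ r × u ≡ parent v)
    edge? u v = ¬? (v ≟ r) ×-dec (u ≟ parent v)

  treeGraph : Subgraph D
  treeGraph = record
    { verts = Subset.⊤
    ; graph = record { arc = λ u v → does (edge? u v) }
    ; arc⊆ = λ {u} {v} e → case T-does⁻ (edge? u v) e of
        λ { (v≢r , refl) → parentArc ∈⊤ v≢r }
    ; tail∈ = λ _ → ∈⊤
    ; head∈ = λ _ → ∈⊤
    }

  open Subgraph treeGraph

  private
    edge : ∀ {u v} → Arc u v → v ≢ r × u ≡ parent v
    edge {u} {v} = T-does⁻ (edge? u v)

    parentEdge : ∀ {v} → v ≢ r → Arc (parent v) v
    parentEdge {v} v≢r = T-does⁺ (edge? (parent v) v) (v≢r , refl)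

    treeRank< : ∀ {u v} → Arc u v → rank u < rank v
    treeRank< {u} {v} e with v≢r , refl ← edge {u} {v} e = rank< ∈⊤ v≢r

    fromTreeRoot : ∀ v → EqClosure Arc r v
    fromTreeRoot v = fromRoot (λ _ v≢r → fwd (parentEdge v≢r)) ∈⊤

  treeGraph-isOutBranching : IsOutBranching treeGraph
  treeGraph-isOutBranching = record
    { isOutTree = record
      { isTree = record
        { nonempty = r , ∈⊤
        ; connected = λ {u} {v} _ _ → EqClosure.symmetric _ (fromTreeRoot u) ◅◅ fromTreeRoot v
        ; noShortCycle = λ {u} {v} e e′ → <-asym (treeRank< {u} {v} e) (treeRank< {v} {u} e′)
        ; noLongerCycle = acyclic rank (λ {u} {v} → treeRank< {u} {v})
            λ {u} {u′} {v} e e′ → trans (proj₂ (edge {u} {v} e)) (sym (proj₂ (edge {u′} {v} e′)))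
        }
      ; root = r
      ; root∈ = ∈⊤
      ; root-indeg = ∣p∣≡0 λ {u} u∈ → proj₁ (edge {u} (∈-tabulate⁻ u∈)) refl
      ; indeg≡1 = λ {v} _ v≢r →
          ∣p∣≡1 (∈-tabulate⁺ (parentEdge v≢r)) λ {u} u∈ → proj₂ (edge {u} (∈-tabulate⁻ u∈))
      }
    ; spanning = λ _ → ∈⊤
    }

  -- All parents lie in `I`, so every vertex outside `I` is a leaf.
  #leaves-treeGraph : c ≤ #leaves
  #leaves-treeGraph = +-cancelˡ-≤ (∣ I ∣) c #leaves
    (≤-trans ∣I∣+c≤∣S∣ (∣∣-cover Subset.⊤ I _ λ {v} v∈⊤ v∉I → x∈p∩q⁺ (v∈⊤ ,
      ∈-tabulate⁺ (T-does⁺ (outdeg v ℕ.≟ 0) (∣p∣≡0 λ {w} w∈ → v∉I (tail∈I (edge {v} {w} (∈-tabulate⁻ w∈))))))))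
    where
    tail∈I : ∀ {u v} → v ≢ r × u ≡ parent v → u ∈ I
    tail∈I (v≢r , refl) = parent∈I ∈⊤ v≢r

-- Directed paths in an out-tree

module OutTree {n : ℕ} {D : Digraph n} {H : Subgraph D} (isOutTree : IsOutTree H) where
  open Subgraph H public
  open IsOutTree isOutTree public

  leaves : Subset n
  leaves = verts ∩ tabulate (λ v → does (outdeg v ℕ.≟ 0))

  leaves⊆verts : leaves ⊆ verts
  leaves⊆verts = p∩q⊆p verts _

  leaf-noArc : ∀ {u v} → Arc u v → u ∉ leaves
  leaf-noArc {u} e u∈ = ∣p∣≡0⇒x∉p (tabulate (arc u))
    (T-does⁻ (outdeg u ℕ.≟ 0) (∈-tabulate⁻ (proj₂ (x∈p∩q⁻ verts _ u∈)))) (∈-tabulate⁺ e)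

  root-noArc : ∀ {u} → ¬ Arc u root
  root-noArc e = ∣p∣≡0⇒x∉p (tabulate (λ u → arc u root)) root-indeg (∈-tabulate⁺ e)

  parent-unique : ∀ {u u′ v} → Arc u v → Arc u′ v → u ≡ u′
  parent-unique {v = v} e e′ with v ≟ root
  ... | yes refl = contradiction e root-noArc
  ... | no v≢root = ∣p∣≡1⇒x≡y (tabulate (λ u → arc u v)) (indeg≡1 (head∈ e) v≢root) (∈-tabulate⁺ e) (∈-tabulate⁺ e′)

  -- An undirected path from the root is made directed step by step. When it takes an arc backwards,
  -- the directed walk so far must have ended with that same arc, which is dropped.
  fromRoot : ∀ {v} → v ∈ verts → Star Arc root v
  fromRoot v∈ = invariant (Star Arc root) extend (IsTree.connected isTree root∈ v∈) ε
    where
    extend : ∀ {u v} → SymClosure Arc u v → Star Arc root u → Star Arc root v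
    extend (fwd e) w = w ◅ʳ e
    extend (bwd e) w with unsnoc w
    ... | inj₁ refl = contradiction e root-noArc
    ... | inj₂ (_ , w′ , e′) = subst (Star Arc root) (parent-unique e′ e) w′

  -- A walk from the root to `v`, stopped at its first visit to `v`, enters `v` from its only parent
  -- `u`.
  fromRoot-avoidingHead : ∀ {u v} → Arc u v → Walk Arc (_≢ v) root u × u ≢ v
  fromRoot-avoidingHead e with unsnoc (truncate (fromRoot (head∈ e)))
  ... | inj₁ refl = contradiction e root-noArc
  ... | inj₂ (_ , w , u′≢v , e′) with refl ← parent-unique e′ e = w , u′≢v

  toDigraph : ∀ {P u v} → Walk Arc P u v → Walk (Digraph.Arc D) P u v
  toDigraph = Star.map λ (Pu , e) → Pu , arc⊆ e

  -- Every vertex but the last has an out-arc in the tree.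
  leafAvoiding : ∀ {u v} → Star Arc u v → Walk (Digraph.Arc D) (_∉ leaves) u v
  leafAvoiding = Star.map λ e → leaf-noArc e , arc⊆ e

-- Dominance, and walks avoiding half of a set

module Dominance {n : ℕ} (D : Digraph n) (r : Fin n) where
  open Digraph D

  -- The vertex d dominates v (with respect to r) when ¬ Avoiding d v; in
  -- particular d dominates itself.
  Avoiding : Rel (Fin n) 0ℓ
  Avoiding d v = Walk Arc (_≢ d) r v × v ≢ d

  avoiding? : ∀ d v → Dec (Avoiding d v)
  avoiding? d v = walk? D r (λ u → ¬? (u ≟ d)) v ×-dec ¬? (v ≟ d)

  avoiding-step : ∀ {d u v} → Avoiding d u → Arc u v → v ≢ d → Avoiding d v
  avoiding-step (w , u≢d) e v≢d = w ◅ʳ (u≢d , e) , v≢d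

  -- Whenever the walk to q meets f, restart it with a walk to f avoiding N, and
  -- give up avoiding g instead; symmetrically for g.
  exchange : ∀ {N Y f g q} → Y ⊆ N → f ∉ Y → g ∉ Y → f ∈ N → g ∈ N → g ≢ f →
    Walk Arc (_∉ N) r f → Walk Arc (_∉ N) r g → Walk Arc (_∉ Y) r q →
    Walk Arc (_∉ Y ∪ ⁅ f ⁆) r q ⊎ Walk Arc (_∉ Y ∪ ⁅ g ⁆) r q
  exchange {N} {Y} {f} {g} Y⊆N f∉Y g∉Y f∈N g∈N g≢f wf wg w =
    invariant (λ v → Walk Arc (_∉ Y ∪ ⁅ f ⁆) r v ⊎ Walk Arc (_∉ Y ∪ ⁅ g ⁆) r v) extend w (inj₁ ε)
    where
    add : ∀ {x v} → v ∉ Y → v ≢ x → v ∉ Y ∪ ⁅ x ⁆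
    add v∉Y v≢x v∈ = v∉Y (∈-∪⁅⁆⁻ Y v∈ v≢x)
    weaken : ∀ {x v} → x ∈ N → Walk Arc (_∉ N) r v → Walk Arc (_∉ Y ∪ ⁅ x ⁆) r v
    weaken {x} x∈N = Star.map λ (u∉N , e) → add (λ u∈Y → u∉N (Y⊆N u∈Y)) (λ { refl → u∉N x∈N }) , e
    extend : ∀ {u v} → u ∉ Y × Arc u v →
      Walk Arc (_∉ Y ∪ ⁅ f ⁆) r u ⊎ Walk Arc (_∉ Y ∪ ⁅ g ⁆) r u →
      Walk Arc (_∉ Y ∪ ⁅ f ⁆) r v ⊎ Walk Arc (_∉ Y ∪ ⁅ g ⁆) r v
    extend {u} (u∉Y , e) (inj₁ w) with u ≟ f
    ... | yes refl = inj₂ (weaken g∈N wf ◅ʳ (add f∉Y (g≢f ∘ sym) , e))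
    ... | no u≢f   = inj₁ (w ◅ʳ (add u∉Y u≢f , e))
    extend {u} (u∉Y , e) (inj₂ w) with u ≟ g
    ... | yes refl = inj₁ (weaken f∈N wg ◅ʳ (add g∉Y g≢f , e))
    ... | no u≢g   = inj₂ (w ◅ʳ (add u∉Y u≢g , e))

  -- If q is not reachable avoiding N, then N contains two vertices f and g that are,
  -- since a single one would dominate q; recurse on N - f - g.
  halve : ∀ {q} → Star Arc r q → ∀ N → Acc Subset._⊂_ N → (∀ {d} → d ∈ N → Avoiding d q) →
    ∃[ Y ] Y ⊆ N × ∣ N ∣ ≤ ∣ Y ∣ + ∣ Y ∣ × Walk Arc (_∉ Y) r q
  halve {q} r⇝q N (acc rec) avoids
    with walk? D r (λ u → ¬? (u ∈? N)) q
  ... | yes w = N , (λ x∈ → x∈) , m≤m+n _ _ , w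
  ... | no ¬w
    with any? (λ f → (f ∈? N) ×-dec walk? D r (λ u → ¬? (u ∈? N)) f)
  ... | no none = contradiction
    (invariant (Walk Arc (_∉ N) r) (λ {u} e w → w ◅ʳ ((λ u∈N → none (u , u∈N , w)) , e)) r⇝q ε) ¬w
  ... | yes (f , f∈N , wf)
    with any? (λ g → (g ∈? N) ×-dec walk? D r (λ u → ¬? (u ∈? N)) g ×-dec ¬? (g ≟ f))
  -- If no vertex of `N` other than `f` can be reached first, the walk to `q` that avoids `f` never
  -- passes through `N`.
  ... | no none = contradiction
    (invariant (Walk Arc (_∉ N) r)
      (λ {u} (u≢f , e) w → w ◅ʳ ((λ u∈N → none (u , u∈N , w , u≢f)) , e))
      (proj₁ (avoids f∈N)) ε) ¬w
  ... | yes (g , g∈N , wg , g≢f) = finish (exchange (λ y∈ → N′⊆N (Y⊆N′ y∈)) f∉Y g∉Y f∈N g∈N g≢f wf wg w)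
    where
    N′ : Subset n
    N′ = N - f - g
    N′⊆N-f : N′ ⊆ N - f
    N′⊆N-f = p─q⊆p (N - f) ⁅ g ⁆
    N′⊆N : N′ ⊆ N
    N′⊆N x∈ = p─q⊆p N ⁅ f ⁆ (N′⊆N-f x∈)
    N′⊂N : N′ Subset.⊂ N
    N′⊂N = N′⊆N , f , f∈N , λ f∈N′ → x∈p-y⇒x≢y N (N′⊆N-f f∈N′) refl
    IH : ∃[ Y ] Y ⊆ N′ × ∣ N′ ∣ ≤ ∣ Y ∣ + ∣ Y ∣ × Walk Arc (_∉ Y) r q
    IH = halve r⇝q N′ (rec N′⊂N) λ d∈ → avoids (N′⊆N d∈)
    Y : Subset n
    Y = proj₁ IH
    Y⊆N′ : Y ⊆ N′
    Y⊆N′ = proj₁ (proj₂ IH)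
    ∣N′∣≤ : ∣ N′ ∣ ≤ ∣ Y ∣ + ∣ Y ∣
    ∣N′∣≤ = proj₁ (proj₂ (proj₂ IH))
    w : Walk Arc (_∉ Y) r q
    w = proj₂ (proj₂ (proj₂ IH))
    f∉Y : f ∉ Y
    f∉Y f∈Y = x∈p-y⇒x≢y N (N′⊆N-f (Y⊆N′ f∈Y)) refl
    g∉Y : g ∉ Y
    g∉Y g∈Y = x∈p-y⇒x≢y (N - f) (Y⊆N′ g∈Y) refl
    grown : ∀ {x} → x ∈ N → x ∉ Y → Walk Arc (_∉ Y ∪ ⁅ x ⁆) r q →
      ∃[ Y ] Y ⊆ N × ∣ N ∣ ≤ ∣ Y ∣ + ∣ Y ∣ × Walk Arc (_∉ Y) r q
    grown {x} x∈N x∉Y w = Y ∪ ⁅ x ⁆ , ⊆N , size , w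
      where
      ⊆N : Y ∪ ⁅ x ⁆ ⊆ N
      ⊆N z∈ with x∈p∪q⁻ Y ⁅ x ⁆ z∈
      ... | inj₁ z∈Y = N′⊆N (Y⊆N′ z∈Y)
      ... | inj₂ z∈x rewrite x∈⁅y⁆⇒x≡y x z∈x = x∈N
      size : ∣ N ∣ ≤ ∣ Y ∪ ⁅ x ⁆ ∣ + ∣ Y ∪ ⁅ x ⁆ ∣
      -- Two vertices left `N` and one of them is added to `Y`, which preserves the ratio of one
      -- half.
      size = begin
        ∣ N ∣                              ≤⟨ ∣p∣≤1+∣p-x∣ N f ⟩
        1 + ∣ N - f ∣                      ≤⟨ s≤s (∣p∣≤1+∣p-x∣ (N - f) g) ⟩
        2 + ∣ N′ ∣                         ≤⟨ s≤s (s≤s ∣N′∣≤) ⟩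
        2 + (∣ Y ∣ + ∣ Y ∣)                ≡⟨ cong suc (sym (+-suc ∣ Y ∣ ∣ Y ∣)) ⟩
        suc ∣ Y ∣ + suc ∣ Y ∣              ≤⟨ +-mono-≤ (1+∣p∣≤∣p∪⁅x⁆∣ x∉Y) (1+∣p∣≤∣p∪⁅x⁆∣ x∉Y) ⟩
        ∣ Y ∪ ⁅ x ⁆ ∣ + ∣ Y ∪ ⁅ x ⁆ ∣      ∎
        where open ≤-Reasoning
    finish : Walk Arc (_∉ Y ∪ ⁅ f ⁆) r q ⊎ Walk Arc (_∉ Y ∪ ⁅ g ⁆) r q →
      ∃[ Y ] Y ⊆ N × ∣ N ∣ ≤ ∣ Y ∣ + ∣ Y ∣ × Walk Arc (_∉ Y) r q
    finish (inj₁ w) = grown f∈N f∉Y w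
    finish (inj₂ w) = grown g∈N g∉Y w

-- Leaves that dominate the tree root

module _ {n : ℕ} {D : Digraph n} (r : Fin n) (reach : ∀ v → Star (Digraph.Arc D) r v)
  {H : Subgraph D} (isOutTree : IsOutTree H) (r∉H : r ∉ Subgraph.verts H)
  (root∉leaves : IsOutTree.root isOutTree ∉ OutTree.leaves isOutTree)
  (useful : ∀ {u v} → Subgraph.Arc H u v → Dominance.Avoiding D r v u) where

  private module T = OutTree isOutTree
  open Digraph D
  open Dominance D r

  r≢leaf : ∀ {d} → d ∈ T.leaves → r ≢ d
  r≢leaf d∈ refl = r∉H (T.leaves⊆verts d∈)

  -- The induction keeps the arc on which dominance by `d` was last lost. On the tree path to the
  -- parent of a leaf `d` the vertex `d` does not occur, so dominance is never regained and this is
  -- also the first loss.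
  firstUndominated : ∀ {d v} → Star T.Arc T.root v → ¬ Avoiding d T.root → Avoiding d v →
    ∃[ x ] ∃[ y ] T.Arc x y × ¬ Avoiding d x × Avoiding d y × Star T.Arc y v
  firstUndominated {d} w ¬q = invariant
    (λ v → Avoiding d v → ∃[ x ] ∃[ y ] T.Arc x y × ¬ Avoiding d x × Avoiding d y × Star T.Arc y v)
    (λ {u} {v} e IH → extend e IH (avoiding? d u)) w (λ av → contradiction av ¬q)
    where
    extend : ∀ {u v} → T.Arc u v →
      (Avoiding d u → ∃[ x ] ∃[ y ] T.Arc x y × ¬ Avoiding d x × Avoiding d y × Star T.Arc y u) →
      Dec (Avoiding d u) → Avoiding d v →
      ∃[ x ] ∃[ y ] T.Arc x y × ¬ Avoiding d x × Avoiding d y × Star T.Arc y v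
    extend e IH (yes au) av = let x , y , e′ , ¬x , ay , w = IH au in x , y , e′ , ¬x , ay , w ◅ʳ e
    extend e IH (no ¬au) av = _ , _ , e , ¬au , av , ε

  -- By contraposition, `dominators` says that every leaf other than `d` that dominates `d` also
  -- dominates `y`.
  record Bypass (d y : Fin n) : Set where
    field
      avoids-d   : Avoiding d y
      avoids-y   : Walk Arc (_≢ y) r d
      dominators : ∀ {e} → e ∈ T.leaves → e ≢ d → Avoiding e y → Avoiding e d

  -- y is the first vertex on the tree path from the root to the leaf d that d does
  -- not dominate; it does not dominate d because the arc into y is useful.
  bypass : ∀ {d} → d ∈ T.leaves → ¬ Avoiding d T.root → ∃[ y ] Bypass d y
  bypass {d} d∈ ¬q with unsnoc (T.fromRoot (T.leaves⊆verts d∈))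
  ... | inj₁ refl = contradiction d∈ root∉leaves
  ... | inj₂ (u , w , e) = bypassAt (firstUndominated w ¬q (useful e))
    where
    bypassAt : ∃[ x ] ∃[ y ] T.Arc x y × ¬ Avoiding d x × Avoiding d y × Star T.Arc y u →
      ∃[ y ] Bypass d y
    bypassAt (x , y , e′ , ¬x , ay , w′) = y , record
      { avoids-d = ay
      -- Some walk to `x` avoids `y`, and it must visit `d`, since `d` dominates `x`; its part up to
      -- `d` is the required walk.
      ; avoids-y = dropAvoidance (firstVisit d (proj₁ (useful e′)))
      -- The tree path from `y` to `d` meets no leaf before its end, so it extends a walk avoiding
      -- `e`.
      ; dominators = λ e∈ e≢d (w₀ , _) →
          w₀ ◅◅ Star.map (λ (u∉ , a) → (λ { refl → u∉ e∈ }) , a) (T.leafAvoiding (w′ ◅ʳ e)) ,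
          e≢d ∘ sym
      }
      where
      dropAvoidance : Walk (λ u v → u ≢ y × Arc u v) (_≢ d) r d ⊎
                      Walk (λ u v → u ≢ y × Arc u v) (_≢ d) r x → Walk Arc (_≢ y) r d
      dropAvoidance (inj₁ w) = Star.map proj₂ w
      dropAvoidance (inj₂ w) with x ≟ d
      ... | yes refl = Star.map proj₂ w
      ... | no  x≢d  = contradiction (Star.map (λ (u≢d , _ , a) → u≢d , a) w , x≢d) ¬x

  -- Otherwise follow a walk from `r` to the tree root. On meeting `d` while avoiding `d`, switch to
  -- a walk to `d` that avoids `e`, and vice versa; the tree root is then reached avoiding one of
  -- its dominators.
  comparable : ∀ {d e} → d ∈ T.leaves → ¬ Avoiding d T.root → ¬ Avoiding e T.root →
    Avoiding d e → ¬ Avoiding e d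
  comparable {d} {e} d∈ ¬d ¬e de ed with invariant (λ v → Avoiding d v ⊎ Avoiding e v)
    extend (reach T.root) (inj₁ (ε , r≢leaf d∈))
    where
    extend : ∀ {u v} → Arc u v → Avoiding d u ⊎ Avoiding e u → Avoiding d v ⊎ Avoiding e v
    extend {v = v} a (inj₁ du) with v ≟ d
    ... | yes refl = inj₂ ed
    ... | no  v≢d  = inj₁ (avoiding-step du a v≢d)
    extend {v = v} a (inj₂ eu) with v ≟ e
    ... | yes refl = inj₁ de
    ... | no  v≢e  = inj₂ (avoiding-step eu a v≢e)
  ... | inj₁ d-root = ¬d d-root
  ... | inj₂ e-root = ¬e e-root

  module _ (X : Subset n) (X⊆leaves : X ⊆ T.leaves)
    (dominates : ∀ {d} → d ∈ X → ¬ Avoiding d T.root) where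

    private
      -- The function is total so that its image can be formed; outside `X` the value `d` is a mere
      -- default.
      bypassed : ∀ d → ∃[ y ] (d ∈ X → Bypass d y)
      bypassed d with d ∈? X
      ... | yes d∈ = let y , b = bypass (X⊆leaves d∈) (dominates d∈) in y , λ _ → b
      ... | no d∉  = d , λ d∈ → contradiction d∈ d∉

      alt : Fin n → Fin n
      alt d = proj₁ (bypassed d)

      open module B {d} (d∈ : d ∈ X) = Bypass (proj₂ (bypassed d) d∈)

      incomparable : ∀ {d e} → d ∈ X → e ∈ X → Avoiding d e → ¬ Avoiding e d
      incomparable d∈ e∈ = comparable (X⊆leaves d∈) (dominates d∈) (dominates e∈)

      alt-image? : ∀ v → Dec (∃[ d ] d ∈ X × alt d ≡ v)
      alt-image? v = any? λ d → d ∈? X ×-dec alt d ≟ v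

      Y : Subset n
      Y = ⟦ alt-image? ⟧

      Reached : Pred (Fin n) 0ℓ
      Reached = Walk Arc (_∉ Y) r

      -- A vertex alt e ∈ Y on the walk is not dominated by e, and e ≢ d dominates d.
      -- As e also dominates v, the walk meets e later, where it can be restarted
      -- with a walk to e avoiding Y.
      reachFrom : ∀ {d v} → d ∈ X →
        (∀ {e} → e ∈ X → e ≢ d → ¬ Avoiding e d → Reached e) →
        (∀ {e} → e ∈ X → e ≢ d → ¬ Avoiding e d → ¬ Avoiding e v) →
        Walk Arc (λ u → u ≢ d × u ≢ alt d) r v → Reached v
      reachFrom {d} {v} d∈ reached dominated w = conclude (invariant K extend w (ε , inj₁ ε))
        where
        Escaped : Pred (Fin n) 0ℓ
        Escaped z = ∃[ e ] e ∈ X × e ≢ d × ¬ Avoiding e d × Avoiding e z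

        K : Pred (Fin n) 0ℓ
        K z = Walk Arc (_≢ d) r z × (Reached z ⊎ Escaped z)

        escape : ∀ {u z} → Arc u z → Escaped u → Reached z ⊎ Escaped z
        escape {z = z} a (e , e∈ , e≢d , ¬ed , eu) with z ≟ e
        ... | yes refl = inj₁ (reached e∈ e≢d ¬ed)
        ... | no  z≢e  = inj₂ (e , e∈ , e≢d , ¬ed , avoiding-step eu a z≢e)

        extend : ∀ {u z} → (u ≢ d × u ≢ alt d) × Arc u z → K u → K z
        extend ((u≢d , _) , a) (w , inj₂ esc) = w ◅ʳ (u≢d , a) , escape a esc
        extend {u} ((u≢d , u≢yd) , a) (w , inj₁ ru) with u ∈? Y
        ... | no u∉Y = w ◅ʳ (u≢d , a) , inj₁ (ru ◅ʳ (u∉Y , a))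
        ... | yes u∈Y with ∈-⟦⟧⁻ alt-image? u∈Y
        ... | e , e∈ , refl = w ◅ʳ (u≢d , a) , escape a (e , e∈ , e≢d , ¬ed , avoids-d e∈)
          where
          e≢d : e ≢ d
          e≢d refl = u≢yd refl
          -- The walk so far shows that `d` does not dominate `u`, which is `alt e`; hence `d` does
          -- not dominate `e`, and by comparability `e` dominates `d`.
          ¬ed : ¬ Avoiding e d
          ¬ed = incomparable d∈ e∈
            (dominators e∈ (X⊆leaves d∈) (e≢d ∘ sym) (w , u≢d))

        conclude : K v → Reached v
        conclude (_ , inj₁ rv) = rv
        conclude (_ , inj₂ (e , e∈ , e≢d , ¬ed , ev)) = contradiction ev (dominated e∈ e≢d ¬ed)

      -- Along an arc from `u` to `v`, the dominators of `v` other than `v` already dominate `u`, so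
      -- they have been reached. If `v` is in `X`, they are what `reachFrom` needs for a walk to `v`
      -- that avoids `alt v`.
      reachDominators : ∀ {v} → Star Arc r v → ∀ {e} → e ∈ X → ¬ Avoiding e v → Reached e
      reachDominators w = invariant (λ v → ∀ {e} → e ∈ X → ¬ Avoiding e v → Reached e) extend w
        λ e∈ ¬er → contradiction (ε , r≢leaf (X⊆leaves e∈)) ¬er
        where
        extend : ∀ {u v} → Arc u v → (∀ {e} → e ∈ X → ¬ Avoiding e u → Reached e) →
          ∀ {e} → e ∈ X → ¬ Avoiding e v → Reached e
        extend {u} {v} a IH {e} e∈ ¬ev with v ≟ e
        ... | no v≢e = IH e∈ λ eu → ¬ev (avoiding-step eu a v≢e)
        ... | yes refl = reachFrom e∈
          (λ e′∈ e′≢v ¬e′v → IH e′∈ λ e′u → ¬e′v (avoiding-step e′u a (e′≢v ∘ sym)))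
          (λ _ _ ¬e′v → ¬e′v)
          (Star.map (λ (s≢v , s≢alt , a) → (s≢v , s≢alt) , a) (truncate (avoids-y e∈)))

      -- All of `X` dominates the tree root and so has been reached; moreover the elements of `X`
      -- other than `d` that dominate `d` also dominate `alt d`.
      reachBypass : ∀ {d} → d ∈ X → Reached (alt d)
      reachBypass {d} d∈ = reachFrom d∈
        (λ e∈ _ _ → reachDominators (reach T.root) e∈ (dominates e∈))
        (λ e∈ e≢d ¬ed e-yd → ¬ed (dominators d∈ (X⊆leaves e∈) e≢d e-yd))
        (Star.map (λ (s≢alt , s≢d , a) → (s≢d , s≢alt) , a) (truncate (proj₁ (avoids-d d∈))))

    dominatorLeaves : ∃[ Y ] ∣ X ∣ ≤ ∣ Y ∣ × (∀ {v} → v ∈ Y → Walk Arc (_∉ Y) r v)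
    dominatorLeaves = Y , injection⇒∣p∣≤∣q∣ alt (λ d∈ → ∈-⟦⟧⁺ alt-image? (_ , d∈ , refl)) alt-injective ,
      λ v∈ → case ∈-⟦⟧⁻ alt-image? v∈ of λ { (_ , d∈ , refl) → reachBypass d∈ }
      where
      -- With a common value, neither of two distinct `d` and `e` would dominate the other, against
      -- comparability.
      alt-injective : ∀ {d e} → d ∈ X → e ∈ X → alt d ≡ alt e → d ≡ e
      alt-injective {d} {e} d∈ e∈ eq with d ≟ e
      ... | yes d≡e = d≡e
      ... | no  d≢e = contradiction
        (dominators d∈ (X⊆leaves e∈) (d≢e ∘ sym) (subst (Avoiding e) (sym eq) (avoids-d e∈)))
        (incomparable d∈ e∈
          (dominators e∈ (X⊆leaves d∈) d≢e (subst (Avoiding d) eq (avoids-d d∈))))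

  manyReachedAvoiding : ∀ k → 3 * k ≤ ∣ T.leaves ∣ →
    ∃[ Y ] k ≤ ∣ Y ∣ × (∀ {v} → v ∈ Y → Walk Arc (_∉ Y) r v)
  manyReachedAvoiding k 3k≤ = conclude (k ≤? ∣ X ∣)
    where
    dominator? : ∀ d → Dec (d ∈ T.leaves × ¬ Avoiding d T.root)
    dominator? d = d ∈? T.leaves ×-dec ¬? (avoiding? d T.root)
    nonDominator? : ∀ d → Dec (d ∈ T.leaves × Avoiding d T.root)
    nonDominator? d = d ∈? T.leaves ×-dec avoiding? d T.root
    X N : Subset n
    X = ⟦ dominator? ⟧
    N = ⟦ nonDominator? ⟧

    split : ∣ T.leaves ∣ ≤ ∣ X ∣ + ∣ N ∣
    split = ∣∣-cover T.leaves X N λ {d} d∈ d∉X → ∈-⟦⟧⁺ nonDominator?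
      (d∈ , decidable-stable (avoiding? d T.root) λ ¬d → d∉X (∈-⟦⟧⁺ dominator? (d∈ , ¬d)))

    conclude : Dec (k ≤ ∣ X ∣) → ∃[ Y ] k ≤ ∣ Y ∣ × (∀ {v} → v ∈ Y → Walk Arc (_∉ Y) r v)
    conclude (yes k≤∣X∣) =
      let Y , ∣X∣≤∣Y∣ , reached = dominatorLeaves X (proj₁ ∘ ∈-⟦⟧⁻ dominator?) (proj₂ ∘ ∈-⟦⟧⁻ dominator?)
      in Y , ≤-trans k≤∣X∣ ∣X∣≤∣Y∣ , reached
    conclude (no k≰∣X∣) =
      let Y , Y⊆N , ∣N∣≤ , w = halve (reach T.root) N (⊂-wellFounded N) (proj₂ ∘ ∈-⟦⟧⁻ nonDominator?)
          Y⊆leaves = λ {v} v∈ → proj₁ (∈-⟦⟧⁻ nonDominator? {v} (Y⊆N v∈))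
      -- If `Y` had fewer than `k` elements, there would be fewer than `k + 2k` leaves. The walk to
      -- the tree root avoiding `Y` continues along tree paths, which meet leaves only at their
      -- ends.
      in Y , ≮⇒≥ (λ ∣Y∣<k → <⇒≱ (bound (∣ Y ∣) ∣N∣≤ ∣Y∣<k) 3k≤) ,
         λ v∈ → w ◅◅ Star.map (λ (u∉ , a) → (u∉ ∘ Y⊆leaves) , a)
                       (T.leafAvoiding (T.fromRoot (T.leaves⊆verts (Y⊆leaves v∈))))
      where
      bound : ∀ m → ∣ N ∣ ≤ m + m → m < k → ∣ T.leaves ∣ < 3 * k
      bound m ∣N∣≤ m<k = begin-strict
        ∣ T.leaves ∣       ≤⟨ split ⟩
        ∣ X ∣ + ∣ N ∣      ≤⟨ +-monoʳ-≤ ∣ X ∣ ∣N∣≤ ⟩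
        ∣ X ∣ + (m + m)    <⟨ +-mono-< (≰⇒> k≰∣X∣) (+-mono-< m<k m<k) ⟩
        k + (k + k)        ≡⟨ cong (λ c → k + (k + c)) (sym (+-identityʳ k)) ⟩
        3 * k              ∎
        where open ≤-Reasoning

-- Out-branchings, their maximum, and the conclusion

module _ {n : ℕ} (D : Digraph n) where
  open Digraph D

  BranchingWithLeaves : ℕ → Set
  BranchingWithLeaves k = ∃[ B ] IsOutBranching {D = D} B × k ≤ Subgraph.#leaves B

  -- A decidable form of BranchingWithLeaves k.
  Branchable : ℕ → Set
  Branchable k = ∃[ r ] ∃[ Y ] k ≤ ∣ Y ∣ × ∀ v → Walk Arc (_∉ Y) r v

  -- `NoUselessArcs` provides out-branchings only up to double negation, which decidability removes;
  -- it also drives the search for the maximum.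
  branchable? : ∀ k → Dec (Branchable k)
  branchable? k = any? λ r → anySubset? λ Y →
    k ≤? ∣ Y ∣ ×-dec all? (walk? D r λ v → ¬? (v ∈? Y))

  reachedAvoiding⇒branching : ∀ {k r} → (∀ v → Star Arc r v) →
    ∃[ Y ] k ≤ ∣ Y ∣ × (∀ {v} → v ∈ Y → Walk Arc (_∉ Y) r v) → BranchingWithLeaves k
  reachedAvoiding⇒branching {r = r} reach (Y , k≤ , reachedY) =
    let I , t = spanningTree D r Y reach reachedY
    in treeGraph t , treeGraph-isOutBranching t , ≤-trans k≤ (#leaves-treeGraph t)

  branchable⇒branching : ∀ {k} → Branchable k → BranchingWithLeaves k
  branchable⇒branching (r , Y , k≤ , reached) =
    reachedAvoiding⇒branching (λ v → Star.map proj₂ (reached v)) (Y , k≤ , λ {v} _ → reached v)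

  -- The leaves serve as `Y`, since tree paths from the root meet them only at their ends.
  branching⇒branchable : ∀ {k} → BranchingWithLeaves k → Branchable k
  branching⇒branchable (B , isOutBranching , k≤) =
    root , leaves , k≤ , λ v → leafAvoiding (fromRoot (IsOutBranching.spanning isOutBranching v))
    where open OutTree (IsOutBranching.isOutTree isOutBranching)

  maximalBranching : ∀ {k} → Branchable k → ∃[ m ] (ℓₛ[ D ]≡ m) × k ≤ m
  maximalBranching {k} b = search n (m≤m+n n k) b
    where
    -- Each round raises `k` by one, and `k` cannot exceed `n` because `Y` is a set of vertices, so
    -- the fuel suffices.
    search : ∀ fuel {k} → n ≤ fuel + k → Branchable k → ∃[ m ] (ℓₛ[ D ]≡ m) × k ≤ m
    search fuel {k} n≤ b with branchable? (suc k)
    ... | no ¬b′ =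
      let B , isOB , k≤ = branchable⇒branching b
          bounded = λ B′ isOB′ → ≮⇒≥ λ k< → ¬b′ (branching⇒branchable (B′ , isOB′ , k<))
      in k , ((B , isOB , ≤-antisym (bounded B isOB) k≤) , bounded) , ≤-refl
    search zero       n≤ b | yes (_ , Y , k<∣Y∣ , _) =
      contradiction (≤-trans k<∣Y∣ (≤-trans (∣p∣≤n Y) n≤)) (<-irrefl refl)
    search (suc fuel) {k} n≤ b | yes b′ =
      let m , max , k<m = search fuel (≤-trans n≤ (≤-reflexive (sym (+-suc fuel k)))) b′
      in m , max , <⇒≤ k<m

  -- One of two leaves differs from the root, and the path to it begins with an arc.
  firstArc : ∀ {H : Subgraph D} (isOutTree : IsOutTree H) → 2 ≤ Subgraph.#leaves H →
    ∃[ v ] Subgraph.Arc H (IsOutTree.root isOutTree) v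
  firstArc isOutTree 2≤ with any? (λ v → v ∈? leaves ×-dec ¬? (v ≟ root))
    where open OutTree isOutTree
  ... | no none = contradiction
    (subst (∣ leaves ∣ ≤_) (∣⁅x⁆∣≡1 root) (p⊆q⇒∣p∣≤∣q∣ leaves⊆root)) (<⇒≱ 2≤)
    where
    open OutTree isOutTree
    leaves⊆root : leaves ⊆ ⁅ root ⁆
    leaves⊆root {v} v∈ with v ≟ root
    ... | yes refl   = x∈⁅x⁆ root
    ... | no  v≢root = contradiction (v , v∈ , v≢root) none
  ... | yes (v , v∈ , v≢root) with OutTree.fromRoot isOutTree (OutTree.leaves⊆verts isOutTree v∈)
  ... | ε     = contradiction refl v≢root
  ... | e ◅ _ = _ , e

  module _ (noUseless : NoUselessArcs D) {H : Subgraph D} (isOutTree : IsOutTree H) where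
    private module T = OutTree isOutTree

    -- An out-branching through uv gives a walk from its own root to u that
    -- avoids v; if prefixing it with a walk from r met v, then v would reach r.
    avoidHead : ∀ {r} → (∀ v → Star Arc r v) → ¬ Star Arc T.root r →
      ∀ {u v} → T.Arc u v → Dominance.Avoiding D r v u
    avoidHead {r} reach ¬root⇝r {u} {v} e =
      decidable-stable (avoiding? v u) λ ¬avoid → noUseless u v
        (T.arc⊆ e , λ (B , isOB , e′) → ¬avoid (viaBranching isOB e′))
      where
      open Dominance D r
      v⇝r⊥ : ¬ Star Arc v r
      v⇝r⊥ v⇝r = ¬root⇝r (Star.map proj₂ (T.leafAvoiding (T.fromRoot (T.head∈ e))) ◅◅ v⇝r)
      viaBranching : ∀ {B} → IsOutBranching {D = D} B → Subgraph.Arc B u v → Avoiding v u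
      viaBranching isOB e′ with invariant (λ z → Walk Arc (_≢ v) r z ⊎ Star Arc v z) extend (reach B.root) (inj₁ ε)
        where
        module B = OutTree (IsOutBranching.isOutTree isOB)
        extend : ∀ {s t} → Arc s t → Walk Arc (_≢ v) r s ⊎ Star Arc v s →
          Walk Arc (_≢ v) r t ⊎ Star Arc v t
        extend a (inj₂ w) = inj₂ (w ◅ʳ a)
        extend {s} a (inj₁ w) with s ≟ v
        ... | yes refl = inj₂ (a ◅ ε)
        ... | no  s≢v  = inj₁ (w ◅ʳ (s≢v , a))
      ... | inj₁ w = let w′ , u≢v = B.fromRoot-avoidingHead e′ in w ◅◅ B.toDigraph w′ , u≢v
        where module B = OutTree (IsOutBranching.isOutTree isOB)
      -- Here `v` reaches the root of the out-branching and, as that spans, also `r`.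
      ... | inj₂ w = contradiction
        (w ◅◅ Star.map proj₂ (B.leafAvoiding (B.fromRoot (IsOutBranching.spanning isOB r)))) v⇝r⊥
        where module B = OutTree (IsOutBranching.isOutTree isOB)

    manyLeaves : ∀ k → k ≥ 1 → 3 * k ≤ T.#leaves → BranchingWithLeaves k
    -- That any out-branching exists is drawn from an arc of the out-tree not being useless; there
    -- is such an arc because `3 * k` is at least 2.
    manyLeaves k k≥1 3k≤ = branchable⇒branching (decidable-stable (branchable? k) λ ¬b →
      let _ , e = firstArc isOutTree 2≤
      in noUseless _ _ (T.arc⊆ e , λ (B , isOB , _) → ¬b (branching⇒branchable (fromBranching isOB))))
      where
      2≤ : 2 ≤ T.#leaves
      2≤ = ≤-trans (n≤1+n 2) (≤-trans (*-monoʳ-≤ 3 k≥1) 3k≤)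

      fromBranching : ∀ {B} → IsOutBranching {D = D} B → BranchingWithLeaves k
      fromBranching isOB = byCases (walk? D T.root U? r)
        where
        module B = OutTree (IsOutBranching.isOutTree isOB)
        r : Fin n
        r = B.root
        reach : ∀ v → Star Arc r v
        reach v = Star.map proj₂ (B.leafAvoiding (B.fromRoot (IsOutBranching.spanning isOB v)))
        byCases : Dec (Walk Arc U T.root r) → BranchingWithLeaves k
        byCases (yes w) = reachedAvoiding⇒branching (λ v → Star.map proj₂ w ◅◅ reach v)
          (T.leaves , ≤-trans (m≤n*m k 3) 3k≤ ,
            λ v∈ → T.leafAvoiding (T.fromRoot (T.leaves⊆verts v∈)))
        byCases (no ¬w) = reachedAvoiding⇒branching reach
          (manyReachedAvoiding r reach isOutTree r∉T root∉leaves (avoidHead reach ¬root⇝r) k 3k≤)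
          where
          ¬root⇝r : ¬ Star Arc T.root r
          ¬root⇝r w = ¬w (Star.map (λ a → _ , a) w)
          r∉T : r ∉ T.verts
          r∉T r∈ = ¬root⇝r (Star.map proj₂ (T.leafAvoiding (T.fromRoot r∈)))
          root∉leaves : T.root ∉ T.leaves
          root∉leaves = T.leaf-noArc (proj₂ (firstArc isOutTree 2≤))

theorem3 : ∀ n (D : Digraph n) (k : ℕ) → k ≥ 1 → NoUselessArcs D →
    ∀ m → ℓ[ D ]≡ m → m ≥ 3 * k →
    ∃[ mₛ ] (ℓₛ[ D ]≡ mₛ) × mₛ ≥ k
theorem3 n D k k≥1 noUseless m ((H , isOutTree , refl) , _) m≥3k =
  maximalBranching D (branching⇒branchable D (manyLeaves D noUseless isOutTree k k≥1 m≥3k))
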